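{- Let $G$ be a finite simple graph with $|V(G)|=n$. Then: (i) if $G$ is connected, then $\widetilde{d}(G,n)=1$ and $\widetilde{d}(G,n-1)=n$; (ii) for every integer $i \ge 0$, $\widetilde{d}(G,i)=0$ if and only if $i<\widetilde{\gamma}_c(G)$ or $i>n$; (iii) $\widetilde{D}(G,x)$ has no constant term (its constant coefficient is $0$); (iv) $\widetilde{D}(G,x)$, viewed as a real function of $x$, is strictly increasing on $[1,\infty)$; (v) for every induced subgraph $H$ of $G$, $\deg \widetilde{D}(G,x)\ge \deg \widetilde{D}(H,x)$; (vi) zero is a root of $\widetilde{D}(G,x)$ with multiplicity $\widetilde{\gamma}_c(G)$; (vii) for every spanning subgraph $H$ of $G$, $\widetilde{\gamma}_c(G)\le\widetilde{\gamma}_c(H)$.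
   Context: All graphs are finite, simple, and have nonempty vertex set. A set $S\subseteq V(G)$ is a dominating set of $G$ if every vertex of $V(G)\setminus S$ is adjacent to at least one vertex of $S$. A set $S\subseteq V(G)$ is an outer-connected dominating set (ocd-set) of $G$ if $S$ is a dominating set of $G$ and either $S=V(G)$ or the subgraph of $G$ induced by $V(G)\setminus S$ is connected. The outer-connected domination number $\widetilde{\gamma}_c(G)$ is the minimum cardinality of an ocd-set of $G$. Let $\widetilde{d}(G,i)$ be the number of ocd-sets of $G$ of cardinality $i$. The outer-connected domination polynomial of $G$ is $\widetilde{D}(G,x)=\sum_{i=\widetilde{\gamma}_c(G)}^{|V(G)|}\widetilde{d}(G,i)\,x^i$. A spanning subgraph of $G$ is a subgraph with the same vertex set as $G$.
   Formalization: In (i), the equation d̃(G,n−1)=n is stated only for n ≥ 2, since it fails for the one-vertex graph (connected, n=1), where the empty set is not dominating and so d̃(G,0)=0. -}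

module Defs where

open import Data.Nat.Base as ℕ using (ℕ; zero; suc; _∸_)
import Data.Nat.Properties as ℕ
open import Data.Integer.Base as ℤ using (ℤ; 0ℤ; 1ℤ; +_)
import Data.Integer.Properties as ℤ
open import Data.Rational.Base as ℚ using (ℚ; 0ℚ; 1ℚ; ½)
import Data.Rational.Properties as ℚ
open import Data.Rational.Solver using (module +-*-Solver)
open import Data.Fin.Base using (Fin)
import Data.Fin.Properties as Fin
open import Data.Fin.Subset using (Subset; inside; outside; ⊤; ∁; ∣_∣; _∈_; _∉_)
open import Data.Fin.Subset.Properties using (_∈?_)
import Data.Bool.Properties as Bool
import Data.Vec.Base as Vec
import Data.Vec.Properties as Vec
open import Data.Vec.Properties.WithK using ([]=-irrelevant)
open import Data.List.Base as List
  using (List; []; _∷_; _++_; map; filter; foldr; length; replicate; upTo; applyUpTo; allFin)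
open import Data.List.Extrema.Nat using (min; max)
import Data.List.Membership.Propositional as List
open import Data.List.Membership.Propositional.Properties using (∈-allFin)
open import Data.List.Relation.Unary.Any using (here; there)
open import Data.Product.Base using (∃; ∃-syntax; _×_; _,_; proj₁; proj₂)
open import Data.Sum.Base using (_⊎_; inj₁; inj₂)
open import Function.Bundles using (_↔_; _⇔_; Inverse)
open import Level using (0ℓ)
open import Relation.Binary.Core using (Rel)
open import Relation.Binary.Definitions using (Decidable; Symmetric; Irreflexive)
open import Relation.Binary.Construct.Closure.ReflexiveTransitive as Star
  using (Star; ε; _◅_; _◅◅_)
open import Relation.Binary.PropositionalEquality
  using (_≡_; _≢_; refl; sym; trans; cong; subst)
open import Relation.Nullary.Decidable using (Dec; map′; _×-dec_; _⊎-dec_; _→-dec_; ¬?)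
open import Relation.Nullary.Negation using (¬_)
import Relation.Unary as Unary

record Graph (V : Set) : Set₁ where
  field
    Adj     : Rel V 0ℓ
    adj?    : Decidable Adj
    adj-sym : Symmetric Adj
    irrefl  : Irreflexive _≡_ Adj

open Graph public

Connected : {V : Set} → Graph V → Set
Connected G = ∀ u v → Star (Adj G) u v

_[_] : ∀ {n} → Graph (Fin n) → (U : Subset n) → Graph (∃[ v ] v ∈ U)
G [ U ] = record
  { Adj     = λ u v → Adj G (proj₁ u) (proj₁ v)
  ; adj?    = λ u v → adj? G (proj₁ u) (proj₁ v)
  ; adj-sym = adj-sym G
  ; irrefl  = λ u≡v → irrefl G (cong proj₁ u≡v)
  }

record _≅_ {V W : Set} (G : Graph V) (H : Graph W) : Set where
  field
    bijection : V ↔ W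
    adj⇔adj   : ∀ u v → Adj G u v ⇔ Adj H (Inverse.to bijection u) (Inverse.to bijection v)

_IsInducedSubgraphOf_ : ∀ {m n} → Graph (Fin m) → Graph (Fin n) → Set
H IsInducedSubgraphOf G = ∃[ U ] H ≅ (G [ U ])

_IsSpanningSubgraphOf_ : {V : Set} → Graph V → Graph V → Set
H IsSpanningSubgraphOf G = ∀ u v → Adj H u v → Adj G u v

-- Reachability in a finite relation is decidable: Via ws relates u and v when
-- some walk from u to v has all its inner vertices in ws (Warshall).

module _ {n} {E : Rel (Fin n) 0ℓ} (E? : Decidable E) where

  private
    Via : List (Fin n) → Rel (Fin n) 0ℓ
    Via []       u v = u ≡ v ⊎ E u v
    Via (w ∷ ws) u v = Via ws u v ⊎ (Via ws u w × Via ws w v)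

    via? : ∀ ws → Decidable (Via ws)
    via? []       u v = (u Fin.≟ v) ⊎-dec E? u v
    via? (w ∷ ws) u v = via? ws u v ⊎-dec (via? ws u w ×-dec via? ws w v)

    via⇒star : ∀ ws {u v} → Via ws u v → Star E u v
    via⇒star []       (inj₁ refl)    = ε
    via⇒star []       (inj₂ e)       = e ◅ ε
    via⇒star (w ∷ ws) (inj₁ p)       = via⇒star ws p
    via⇒star (w ∷ ws) (inj₂ (p , q)) = via⇒star ws p ◅◅ via⇒star ws q

    base⇒via : ∀ ws {u v} → u ≡ v ⊎ E u v → Via ws u v
    base⇒via []       p = p
    base⇒via (w ∷ ws) p = inj₁ (base⇒via ws p)

    to-head : ∀ {w ws u} → Via (w ∷ ws) u w → Via ws u w
    to-head (inj₁ p)       = p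
    to-head (inj₂ (p , _)) = p

    from-head : ∀ {w ws v} → Via (w ∷ ws) w v → Via ws w v
    from-head (inj₁ p)       = p
    from-head (inj₂ (_ , p)) = p

    join : ∀ {ws w u v} → w List.∈ ws → Via ws u w → Via ws w v → Via ws u v
    join (here refl) p              q              = inj₂ (to-head p , from-head q)
    join (there i)   (inj₁ p)       (inj₁ q)       = inj₁ (join i p q)
    join (there i)   (inj₁ p)       (inj₂ (q , r)) = inj₂ (join i p q , r)
    join (there i)   (inj₂ (p , q)) (inj₁ r)       = inj₂ (p , join i q r)
    join (there i)   (inj₂ (p , _)) (inj₂ (_ , r)) = inj₂ (p , r)

    star⇒via : ∀ {u v} → Star E u v → Via (allFin n) u v
    star⇒via ε        = base⇒via (allFin n) (inj₁ refl)
    star⇒via (e ◅ es) = join (∈-allFin _) (base⇒via (allFin n) (inj₂ e)) (star⇒via es)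

  star? : Decidable (Star E)
  star? u v = map′ (via⇒star (allFin n)) star⇒via (via? (allFin n) u v)

module _ {n} (G : Graph (Fin n)) (U : Subset n) where

  private
    E : Rel (Fin n) 0ℓ
    E u v = u ∈ U × v ∈ U × Adj G u v

    E? : Decidable E
    E? u v = (u ∈? U) ×-dec ((v ∈? U) ×-dec adj? G u v)

    project : ∀ {u v} → Star (Adj (G [ U ])) u v → Star E (proj₁ u) (proj₁ v)
    project = Star.gmap proj₁ λ {u} {v} e → proj₂ u , proj₂ v , e

    lift : ∀ {u v} (p : u ∈ U) (q : v ∈ U) → Star E u v → Star (Adj (G [ U ])) (u , p) (v , q)
    lift p q ε                  = subst (λ r → Star _ _ (_ , r)) ([]=-irrelevant p q) ε
    lift p q ((_ , r , e) ◅ es) = e ◅ lift r q es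

  connected? : Dec (Connected (G [ U ]))
  connected? = map′
    (λ c (u , p) (v , q) → lift p q (c u p v q))
    (λ c u p v q → project (c (u , p) (v , q)))
    (Fin.all? λ u → (u ∈? U) →-dec Fin.all? λ v → (v ∈? U) →-dec star? E? u v)

module _ {n} (G : Graph (Fin n)) where

  IsDominating : Subset n → Set
  IsDominating S = ∀ v → v ∉ S → ∃[ u ] (u ∈ S × Adj G v u)

  IsOCDSet : Subset n → Set
  IsOCDSet S = IsDominating S × (S ≡ ⊤ ⊎ Connected (G [ ∁ S ]))

  isOCDSet? : Unary.Decidable IsOCDSet
  isOCDSet? S =
    (Fin.all? λ v → ¬? (v ∈? S) →-dec Fin.any? λ u → (u ∈? S) ×-dec adj? G v u)
    ×-dec (Vec.≡-dec Bool._≟_ S ⊤ ⊎-dec connected? G (∁ S))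

subsets : ∀ n → List (Subset n)
subsets zero    = Vec.[] ∷ []
subsets (suc n) = map (outside Vec.∷_) (subsets n) ++ map (inside Vec.∷_) (subsets n)

ocdSets : ∀ {n} → Graph (Fin n) → List (Subset n)
ocdSets {n} G = filter (isOCDSet? G) (subsets n)

-- The first argument of min is an upper bound on the result; n is harmless,
-- because the full vertex set is an ocd-set of cardinality n.
γ̃ : ∀ {n} → Graph (Fin n) → ℕ
γ̃ {n} G = min n (map ∣_∣ (ocdSets G))

d̃ : ∀ {n} → Graph (Fin n) → ℕ → ℕ
d̃ G i = length (filter (λ S → ∣ S ∣ ℕ.≟ i) (ocdSets G))

-- Integer polynomials, as lists of coefficients with the constant term first
-- and trailing zeros allowed

Poly : Set
Poly = List ℤ

coeff : Poly → ℕ → ℤ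
coeff []      _       = 0ℤ
coeff (a ∷ p) zero    = a
coeff (a ∷ p) (suc k) = coeff p k

infix  4 _≈ₚ_ _∣ₚ_
infixl 6 _+ₚ_
infixl 7 _*ₚ_
infixr 8 _^ₚ_

_≈ₚ_ : Rel Poly 0ℓ
p ≈ₚ q = ∀ k → coeff p k ≡ coeff q k

_+ₚ_ : Poly → Poly → Poly
[]      +ₚ q       = q
(a ∷ p) +ₚ []      = a ∷ p
(a ∷ p) +ₚ (b ∷ q) = (a ℤ.+ b) ∷ (p +ₚ q)

_*ₚ_ : Poly → Poly → Poly
[]      *ₚ q = []
(a ∷ p) *ₚ q = map (a ℤ.*_) q +ₚ (0ℤ ∷ (p *ₚ q))

_^ₚ_ : Poly → ℕ → Poly
p ^ₚ zero  = 1ℤ ∷ []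
p ^ₚ suc k = p *ₚ (p ^ₚ k)

_∣ₚ_ : Rel Poly 0ℓ
p ∣ₚ q = ∃[ r ] (q ≈ₚ p *ₚ r)

monomial : ℤ → ℕ → Poly
monomial c i = replicate i 0ℤ ++ (c ∷ [])

-- f a + f (a + 1) + ⋯ + f b
sumₚ : (a b : ℕ) → (ℕ → Poly) → Poly
sumₚ a b f = foldr _+ₚ_ [] (applyUpTo (λ k → f (a ℕ.+ k)) (suc b ∸ a))

-- The zero polynomial is given degree 0.
deg : Poly → ℕ
deg p = max 0 (filter (λ k → ¬? (coeff p k ℤ.≟ 0ℤ)) (upTo (length p)))

eval : Poly → ℤ → ℤ
eval p x = foldr (λ a y → a ℤ.+ x ℤ.* y) 0ℤ p

X-_ : ℤ → Poly
X- a = (ℤ.- a) ∷ 1ℤ ∷ []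

record IsRootWithMultiplicity (p : Poly) (a : ℤ) (m : ℕ) : Set where
  field
    isRoot     : eval p a ≡ 0ℤ
    divides    : (X- a) ^ₚ m ∣ₚ p
    notDivides : ¬ ((X- a) ^ₚ suc m ∣ₚ p)

D̃ : ∀ {n} → Graph (Fin n) → Poly
D̃ {n} G = sumₚ (γ̃ G) n λ i → monomial (+ d̃ G i) i

-- Real numbers, as Cauchy sequences of rationals; equal reals may have
-- different representatives, and the relations below do not depend on them.

IsCauchy : (ℕ → ℚ) → Set
IsCauchy s = ∀ e → 0ℚ ℚ.< e →
  ∃[ N ] (∀ i j → N ℕ.≤ i → N ℕ.≤ j → ℚ.∣ s i ℚ.- s j ∣ ℚ.≤ e)

record ℝ : Set where
  constructor mkℝ
  field
    seq    : ℕ → ℚ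
    cauchy : IsCauchy seq

open ℝ public

infix  4 _<ᵣ_ _≤ᵣ_
infixl 6 _+ᵣ_
infixl 7 _*ᵣ_

_<ᵣ_ : Rel ℝ 0ℓ
x <ᵣ y = ∃[ e ] (0ℚ ℚ.< e × ∃[ N ] (∀ i → N ℕ.≤ i → seq x i ℚ.+ e ℚ.≤ seq y i))

_≤ᵣ_ : Rel ℝ 0ℓ
x ≤ᵣ y = ¬ (y <ᵣ x)

private
  open ℚ.≤-Reasoning

  half+half : ∀ e → e ℚ.* ½ ℚ.+ e ℚ.* ½ ≡ e
  half+half e = trans (sym (ℚ.*-distribˡ-+ e ½ ½)) (ℚ.*-identityʳ e)

  half-pos : ∀ {e} → 0ℚ ℚ.< e → 0ℚ ℚ.< e ℚ.* ½
  half-pos {e} 0<e = ℚ.*-monoˡ-<-pos ½ 0<e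

  const-cauchy : ∀ q → IsCauchy (λ _ → q)
  const-cauchy q e 0<e = 0 , λ _ _ _ _ →
    subst (ℚ._≤ e) (sym (cong ℚ.∣_∣ (ℚ.+-inverseʳ q))) (ℚ.<⇒≤ 0<e)

  +-cauchy : ∀ s t → IsCauchy s → IsCauchy t → IsCauchy (λ i → s i ℚ.+ t i)
  +-cauchy s t cs ct e 0<e
    with M , hM ← cs (e ℚ.* ½) (half-pos 0<e)
    with N , hN ← ct (e ℚ.* ½) (half-pos 0<e)
    = M ℕ.⊔ N , λ i j i≥ j≥ → begin
      ℚ.∣ (s i ℚ.+ t i) ℚ.- (s j ℚ.+ t j) ∣            ≡⟨ cong ℚ.∣_∣ (rearrange (s i) (t i) (s j) (t j)) ⟩
      ℚ.∣ (s i ℚ.- s j) ℚ.+ (t i ℚ.- t j) ∣            ≤⟨ ℚ.∣p+q∣≤∣p∣+∣q∣ (s i ℚ.- s j) (t i ℚ.- t j) ⟩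
      ℚ.∣ s i ℚ.- s j ∣ ℚ.+ ℚ.∣ t i ℚ.- t j ∣          ≤⟨ ℚ.+-mono-≤
                                                            (hM i j (ℕ.m⊔n≤o⇒m≤o M N i≥) (ℕ.m⊔n≤o⇒m≤o M N j≥))
                                                            (hN i j (ℕ.m⊔n≤o⇒n≤o M N i≥) (ℕ.m⊔n≤o⇒n≤o M N j≥)) ⟩
      e ℚ.* ½ ℚ.+ e ℚ.* ½                              ≡⟨ half+half e ⟩
      e                                                ∎
    where
    open +-*-Solver
    rearrange : ∀ a b c d → (a ℚ.+ b) ℚ.- (c ℚ.+ d) ≡ (a ℚ.- c) ℚ.+ (b ℚ.- d)
    rearrange = solve 4 (λ a b c d → (a :+ b) :- (c :+ d) := (a :- c) :+ (b :- d)) refl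

  bound : ∀ s → IsCauchy s →
    ∃[ K ] (0ℚ ℚ.< K × ∃[ N ] (∀ i → N ℕ.≤ i → ℚ.∣ s i ∣ ℚ.≤ K))
  bound s cs with N , hN ← cs 1ℚ (ℚ.positive⁻¹ 1ℚ) =
    1ℚ ℚ.+ ℚ.∣ s N ∣ , ℚ.+-mono-<-≤ (ℚ.positive⁻¹ 1ℚ) (ℚ.0≤∣p∣ (s N)) , N , λ i i≥ → begin
      ℚ.∣ s i ∣                       ≡⟨ cong ℚ.∣_∣ (split (s i) (s N)) ⟩
      ℚ.∣ (s i ℚ.- s N) ℚ.+ s N ∣     ≤⟨ ℚ.∣p+q∣≤∣p∣+∣q∣ (s i ℚ.- s N) (s N) ⟩
      ℚ.∣ s i ℚ.- s N ∣ ℚ.+ ℚ.∣ s N ∣ ≤⟨ ℚ.+-monoˡ-≤ ℚ.∣ s N ∣ (hN i N i≥ ℕ.≤-refl) ⟩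
      1ℚ ℚ.+ ℚ.∣ s N ∣                ∎
    where
    open +-*-Solver
    split : ∀ a b → a ≡ (a ℚ.- b) ℚ.+ b
    split = solve 2 (λ a b → a := (a :- b) :+ b) refl

  mul-≤ : ∀ p q {a b} → ℚ.∣ p ∣ ℚ.≤ a → ℚ.∣ q ∣ ℚ.≤ b → ℚ.∣ p ℚ.* q ∣ ℚ.≤ a ℚ.* b
  mul-≤ p q {a} {b} p≤a q≤b = begin
    ℚ.∣ p ℚ.* q ∣           ≡⟨ ℚ.∣p*q∣≡∣p∣*∣q∣ p q ⟩
    ℚ.∣ p ∣ ℚ.* ℚ.∣ q ∣     ≤⟨ ℚ.*-monoʳ-≤-nonNeg ℚ.∣ q ∣ {{ℚ.nonNegative (ℚ.0≤∣p∣ q)}} p≤a ⟩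
    a ℚ.* ℚ.∣ q ∣           ≤⟨ ℚ.*-monoˡ-≤-nonNeg a {{ℚ.nonNegative (ℚ.≤-trans (ℚ.0≤∣p∣ p) p≤a)}} q≤b ⟩
    a ℚ.* b                 ∎

  shrink : ∀ e K → 0ℚ ℚ.< e → 0ℚ ℚ.< K → ∃[ δ ] (0ℚ ℚ.< δ × K ℚ.* δ ≡ e)
  shrink e K 0<e 0<K = r ℚ.* e , ℚ.positive⁻¹ (r ℚ.* e) {{ℚ.pos*pos⇒pos r e}} ,
    trans (sym (ℚ.*-assoc K r e)) (trans (cong (ℚ._* e) (ℚ.*-inverseʳ K)) (ℚ.*-identityˡ e))
    where
    instance
      K-pos = ℚ.positive 0<K
      K-nonZero = ℚ.pos⇒nonZero K
      e-pos = ℚ.positive 0<e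
      r-pos = ℚ.1/pos⇒pos K
    r = ℚ.1/ K

  *-estimate : ∀ a b c d {K L δ} →
    ℚ.∣ a ∣ ℚ.≤ K → ℚ.∣ d ∣ ℚ.≤ L → ℚ.∣ a ℚ.- c ∣ ℚ.≤ δ → ℚ.∣ b ℚ.- d ∣ ℚ.≤ δ →
    ℚ.∣ a ℚ.* b ℚ.- c ℚ.* d ∣ ℚ.≤ (K ℚ.+ L) ℚ.* δ
  *-estimate a b c d {K} {L} {δ} a≤K d≤L ac≤δ bd≤δ = begin
    ℚ.∣ a ℚ.* b ℚ.- c ℚ.* d ∣                             ≡⟨ cong ℚ.∣_∣ (rearrange a b c d) ⟩
    ℚ.∣ a ℚ.* (b ℚ.- d) ℚ.+ d ℚ.* (a ℚ.- c) ∣             ≤⟨ ℚ.∣p+q∣≤∣p∣+∣q∣ (a ℚ.* (b ℚ.- d)) (d ℚ.* (a ℚ.- c)) ⟩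
    ℚ.∣ a ℚ.* (b ℚ.- d) ∣ ℚ.+ ℚ.∣ d ℚ.* (a ℚ.- c) ∣       ≤⟨ ℚ.+-mono-≤ (mul-≤ a (b ℚ.- d) a≤K bd≤δ) (mul-≤ d (a ℚ.- c) d≤L ac≤δ) ⟩
    K ℚ.* δ ℚ.+ L ℚ.* δ                                   ≡⟨ ℚ.*-distribʳ-+ δ K L ⟨
    (K ℚ.+ L) ℚ.* δ                                       ∎
    where
    open +-*-Solver
    rearrange : ∀ a b c d → a ℚ.* b ℚ.- c ℚ.* d ≡ a ℚ.* (b ℚ.- d) ℚ.+ d ℚ.* (a ℚ.- c)
    rearrange = solve 4 (λ a b c d → a :* b :- c :* d := a :* (b :- d) :+ d :* (a :- c)) refl

  *-cauchy : ∀ s t → IsCauchy s → IsCauchy t → IsCauchy (λ i → s i ℚ.* t i)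
  *-cauchy s t cs ct e 0<e =
    let K , 0<K , A , hA = bound s cs
        L , 0<L , B , hB = bound t ct
        δ , 0<δ , eq = shrink e (K ℚ.+ L) 0<e (ℚ.+-mono-< 0<K 0<L)
        C , hC = cs δ 0<δ
        D , hD = ct δ 0<δ
    in (A ℕ.⊔ B) ℕ.⊔ (C ℕ.⊔ D) , λ i j i≥ j≥ →
      let i≥AB = ℕ.m⊔n≤o⇒m≤o (A ℕ.⊔ B) (C ℕ.⊔ D) i≥
          j≥AB = ℕ.m⊔n≤o⇒m≤o (A ℕ.⊔ B) (C ℕ.⊔ D) j≥
          i≥CD = ℕ.m⊔n≤o⇒n≤o (A ℕ.⊔ B) (C ℕ.⊔ D) i≥
          j≥CD = ℕ.m⊔n≤o⇒n≤o (A ℕ.⊔ B) (C ℕ.⊔ D) j≥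
      in ℚ.≤-trans
        (*-estimate (s i) (t i) (s j) (t j) {K} {L} {δ}
          (hA i (ℕ.m⊔n≤o⇒m≤o A B i≥AB))
          (hB j (ℕ.m⊔n≤o⇒n≤o A B j≥AB))
          (hC i j (ℕ.m⊔n≤o⇒m≤o C D i≥CD) (ℕ.m⊔n≤o⇒m≤o C D j≥CD))
          (hD i j (ℕ.m⊔n≤o⇒n≤o C D i≥CD) (ℕ.m⊔n≤o⇒n≤o C D j≥CD)))
        (ℚ.≤-reflexive eq)

fromℤ : ℤ → ℝ
fromℤ z = mkℝ (λ _ → z ℚ./ 1) (const-cauchy (z ℚ./ 1))

_+ᵣ_ : ℝ → ℝ → ℝ
x +ᵣ y = mkℝ (λ i → seq x i ℚ.+ seq y i) (+-cauchy (seq x) (seq y) (cauchy x) (cauchy y))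

_*ᵣ_ : ℝ → ℝ → ℝ
x *ᵣ y = mkℝ (λ i → seq x i ℚ.* seq y i) (*-cauchy (seq x) (seq y) (cauchy x) (cauchy y))

evalᵣ : Poly → ℝ → ℝ
evalᵣ p x = foldr (λ a y → fromℤ a +ᵣ x *ᵣ y) (fromℤ 0ℤ) p

StrictlyIncreasingOn : (ℝ → Set) → (ℝ → ℝ) → Set
StrictlyIncreasingOn I f = ∀ x y → I x → I y → x <ᵣ y → f x <ᵣ f y

{-# OPTIONS --safe #-}
module Submission where

-- A connected vertex set U contains connected subsets of every size from 1 to
-- |U|, grown from a vertex by repeatedly crossing an edge out of the current
-- subset. Applied to the complement of a minimum ocd-set, and passing to
-- complements again (supersets of dominating sets dominate), this yields ocd-sets
-- of every cardinality from γ̃ to n. Hence the coefficients of D̃ are exactly the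
-- d̃ i, nonnegative and nonzero exactly for γ̃ ≤ i ≤ n, which determines the degree
-- and the multiplicity of the root 0 and makes D̃ increase strictly on positive
-- arguments.

open import Defs
import Algebra.Lattice.Properties.BooleanAlgebra as BooleanAlgebra
open import Data.Nat.Base
  using (ℕ; zero; suc; _+_; _∸_; _⊔_; _≤_; _<_; _≥_; z≤n; s≤s; s≤s⁻¹; z<s; NonZero; >-nonZero⁻¹)
import Data.Nat.Properties as ℕ
open import Data.Nat.Combinatorics
  using (_C_; nCn≡1; nC1≡n; nCk≡nC[n∸k]; nCk+nC[k+1]≡[n+1]C[k+1])
open import Data.Integer.Base as ℤ using (ℤ; 0ℤ; 1ℤ)
import Data.Integer.Properties as ℤ
open import Data.Rational.Base as ℚ using (ℚ; 0ℚ; ½)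
import Data.Rational.Properties as ℚ
open import Data.Fin.Base using (Fin; zero; suc; fromℕ<)
import Data.Fin.Properties as Fin
open import Data.Fin.Subset
  using (Subset; inside; outside; ⊤; ⊥; ∁; ∣_∣; _∈_; _∉_; _⊆_; _∪_; ⁅_⁆; Nonempty)
open import Data.Fin.Subset.Properties
open import Data.List.Base
  using ([]; _∷_; _++_; map; filter; length; drop; foldr; upTo; applyUpTo)
import Data.List.Properties as List
import Data.List.Membership.Propositional as List
import Data.List.Membership.Propositional.Properties as List
open import Data.List.Extrema.Nat using (min≤v⁺; argmin-sel; max≤v⁺; v≤max⁺)
import Data.List.Relation.Unary.All as All
import Data.List.Relation.Unary.All.Properties as All
import Data.List.Relation.Unary.Any as Any
open import Data.Product.Base using (∃-syntax; _×_; _,_; proj₁; proj₂)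
open import Data.Sum.Base using (_⊎_; inj₁; inj₂)
open import Data.Vec.Base using ([]; _∷_; here)
open import Data.Vec.Properties.WithK using ([]=-irrelevant)
open import Function.Base using (_∘_; id)
open import Function.Bundles using (_⇔_; mk⇔; Inverse; Injection)
open import Function.Properties.Inverse using (↔⇒↣)
open import Level using (0ℓ)
open import Relation.Binary.Construct.Closure.ReflexiveTransitive as Star
  using (Star; ε; _◅_; _◅◅_)
open import Relation.Binary.PropositionalEquality
  using (_≡_; _≢_; refl; sym; trans; cong; cong₂; subst; subst₂; module ≡-Reasoning)
open import Relation.Nullary.Decidable using (yes; no; ¬?; _×-dec_; decidable-stable)
open import Relation.Nullary.Negation using (contradiction)
open import Relation.Unary using (Pred; Decidable)

private
  variable
    A B : Set
    n : ℕ

-- Filtering lists.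

length-filter-map : ∀ {P : Pred B 0ℓ} (P? : Decidable P) (f : A → B) xs →
  length (filter P? (map f xs)) ≡ length (filter (P? ∘ f) xs)
length-filter-map P? f []       = refl
length-filter-map P? f (x ∷ xs) with P? (f x)
... | yes _ = cong suc (length-filter-map P? f xs)
... | no _  = length-filter-map P? f xs

filter-filter : ∀ {P Q : Pred A 0ℓ} (P? : Decidable P) (Q? : Decidable Q) →
  (∀ {x} → Q x → P x) → ∀ xs → filter Q? (filter P? xs) ≡ filter Q? xs
filter-filter P? Q? Q⊆P []       = refl
filter-filter P? Q? Q⊆P (x ∷ xs) with P? x
... | no ¬p = trans (filter-filter P? Q? Q⊆P xs) (sym (List.filter-reject Q? (¬p ∘ Q⊆P)))
... | yes _ with Q? x
...   | yes _ = cong (x ∷_) (filter-filter P? Q? Q⊆P xs)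
...   | no _  = filter-filter P? Q? Q⊆P xs

-- Cardinalities of finite subsets.

∣p∪⁅x⁆∣≡1+∣p∣ : ∀ {x} {p : Subset n} → x ∉ p → ∣ p ∪ ⁅ x ⁆ ∣ ≡ suc ∣ p ∣
∣p∪⁅x⁆∣≡1+∣p∣ {x = zero}  {outside ∷ p} x∉p = cong (suc ∘ ∣_∣) (∪-identityʳ p)
∣p∪⁅x⁆∣≡1+∣p∣ {x = zero}  {inside  ∷ p} x∉p = contradiction here x∉p
∣p∪⁅x⁆∣≡1+∣p∣ {x = suc x} {outside ∷ p} x∉p = ∣p∪⁅x⁆∣≡1+∣p∣ (drop-not-there x∉p)
∣p∪⁅x⁆∣≡1+∣p∣ {x = suc x} {inside  ∷ p} x∉p = cong suc (∣p∪⁅x⁆∣≡1+∣p∣ (drop-not-there x∉p))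

x∈p⇒0<∣p∣ : ∀ {x} {p : Subset n} → x ∈ p → 0 < ∣ p ∣
x∈p⇒0<∣p∣ x∈p = ℕ.≤-<-trans z≤n (x∈p⇒∣p-x∣<∣p∣ x∈p)

∣p∣<∣q∣⇒∃∈q∖p : ∀ {p q : Subset n} → ∣ p ∣ < ∣ q ∣ → ∃[ x ] (x ∈ q × x ∉ p)
∣p∣<∣q∣⇒∃∈q∖p {p = p} {q} p<q with Fin.any? (λ x → (x ∈? q) ×-dec ¬? (x ∈? p))
... | yes found = found
... | no ¬found = contradiction (p⊆q⇒∣p∣≤∣q∣ q⊆p) (ℕ.<⇒≱ p<q)
  where
  q⊆p : q ⊆ p
  q⊆p {x} x∈q = decidable-stable (x ∈? p) λ x∉p → ¬found (x , x∈q , x∉p)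

0<∣p∣⇒Nonempty : ∀ {p : Subset n} → 0 < ∣ p ∣ → Nonempty p
0<∣p∣⇒Nonempty {n} {p} 0<p =
  let x , x∈p , _ = ∣p∣<∣q∣⇒∃∈q∖p {p = ⊥} (subst (_< ∣ p ∣) (sym (∣⊥∣≡0 n)) 0<p) in x , x∈p

-- Removing `x` leaves a set of size below 1, yet a `y` different from `x` would survive the
-- removal.
∣p∣≤1⇒≡ : ∀ {p : Subset n} {x y} → ∣ p ∣ ≤ 1 → x ∈ p → y ∈ p → x ≡ y
∣p∣≤1⇒≡ {p = p} {x} {y} p≤1 x∈p y∈p with x Fin.≟ y
... | yes x≡y = x≡y
... | no x≢y  = contradiction
  (ℕ.≤-trans (x∈p⇒∣p-x∣<∣p∣ x∈p) p≤1)
  (ℕ.<⇒≱ (s≤s (x∈p⇒0<∣p∣ (x∈p∧x≢y⇒x∈p-y y∈p (x≢y ∘ sym)))))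

-- Enumerating and counting subsets.

∈-subsets : ∀ (S : Subset n) → S List.∈ subsets n
∈-subsets []            = Any.here refl
∈-subsets (outside ∷ S) = List.∈-++⁺ˡ (List.∈-map⁺ _ (∈-subsets S))
∈-subsets (inside  ∷ S) = List.∈-++⁺ʳ (map (outside ∷_) (subsets _)) (List.∈-map⁺ _ (∈-subsets S))

nC0≡1 : ∀ n → n C 0 ≡ 1
nC0≡1 n = trans (nCk≡nC[n∸k] {0} {n} z≤n) (nCn≡1 n)

-- Pascal's rule: the enumeration splits by whether the first element is outside or inside the set.
#subsets≡nCk : ∀ n k → length (filter (λ S → ∣ S ∣ ℕ.≟ k) (subsets n)) ≡ n C k
#subsets≡nCk zero zero = refl
#subsets≡nCk zero (suc k) = refl
#subsets≡nCk (suc n) k = begin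
  length (filter size? (map (outside ∷_) (subsets n) ++ map (inside ∷_) (subsets n)))
    ≡⟨ cong length (List.filter-++ size? (map (outside ∷_) (subsets n)) _) ⟩
  length (filter size? (map (outside ∷_) (subsets n)) ++ filter size? (map (inside ∷_) (subsets n)))
    ≡⟨ List.length-++ (filter size? (map (outside ∷_) (subsets n))) ⟩
  length (filter size? (map (outside ∷_) (subsets n))) + length (filter size? (map (inside ∷_) (subsets n)))
    ≡⟨ cong₂ _+_ (length-filter-map size? (outside ∷_) (subsets n)) (length-filter-map size? (inside ∷_) (subsets n)) ⟩
  length (filter (λ S → ∣ S ∣ ℕ.≟ k) (subsets n)) + length (filter (λ S → suc ∣ S ∣ ℕ.≟ k) (subsets n))
    ≡⟨ cong₂ _+_ (#subsets≡nCk n k) refl ⟩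
  n C k + length (filter (λ S → suc ∣ S ∣ ℕ.≟ k) (subsets n))
    ≡⟨ pascal k ⟩
  suc n C k ∎
  where
  open ≡-Reasoning
  size? : Decidable (λ (S : Subset (suc n)) → ∣ S ∣ ≡ k)
  size? S = ∣ S ∣ ℕ.≟ k
  pascal : ∀ k → n C k + length (filter (λ S → suc ∣ S ∣ ℕ.≟ k) (subsets n)) ≡ suc n C k
  pascal zero = begin
    n C 0 + length (filter (λ S → suc ∣ S ∣ ℕ.≟ 0) (subsets n))
      ≡⟨ cong (λ xs → n C 0 + length xs) (List.filter-none (λ S → suc ∣ S ∣ ℕ.≟ 0) (All.universal (λ _ ()) (subsets n))) ⟩
    n C 0 + 0      ≡⟨ ℕ.+-identityʳ (n C 0) ⟩
    n C 0          ≡⟨ trans (nC0≡1 n) (sym (nC0≡1 (suc n))) ⟩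
    suc n C 0      ∎
  pascal (suc k) = begin
    n C suc k + length (filter (λ S → suc ∣ S ∣ ℕ.≟ suc k) (subsets n))
      ≡⟨ cong (λ xs → n C suc k + length xs)
           (List.filter-≐ (λ S → suc ∣ S ∣ ℕ.≟ suc k) (λ S → ∣ S ∣ ℕ.≟ k) (ℕ.suc-injective , cong suc) (subsets n)) ⟩
    n C suc k + length (filter (λ S → ∣ S ∣ ℕ.≟ k) (subsets n))
      ≡⟨ cong (n C suc k +_) (#subsets≡nCk n k) ⟩
    n C suc k + n C k  ≡⟨ ℕ.+-comm (n C suc k) (n C k) ⟩
    n C k + n C suc k  ≡⟨ nCk+nC[k+1]≡[n+1]C[k+1] n k ⟩
    suc n C suc k      ∎

-- Growing connected vertex sets.

-- The first step of the walk that leaves `W` is the edge sought.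
crossing-edge : (G : Graph (Fin n)) {U W : Subset n} {u v : ∃[ x ] x ∈ U} →
  Star (Adj (G [ U ])) u v → proj₁ u ∈ W → proj₁ v ∉ W →
  ∃[ a ] ∃[ b ] (a ∈ W × b ∈ U × b ∉ W × Adj G a b)
crossing-edge G ε u∈W v∉W = contradiction u∈W v∉W
crossing-edge G {W = W} (_◅_ {j = x} e es) u∈W v∉W with proj₁ x ∈? W
... | yes x∈W = crossing-edge G es x∈W v∉W
... | no  x∉W = _ , _ , u∈W , proj₂ x , x∉W , e

∣U∣≤1⇒connected : (G : Graph (Fin n)) {U : Subset n} → ∣ U ∣ ≤ 1 → Connected (G [ U ])
∣U∣≤1⇒connected G U≤1 (u , p) (v , q) with refl ← ∣p∣≤1⇒≡ U≤1 p q =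
  -- The endpoints are equal as vertices of `G`, but carry separate membership proofs, which have to
  -- be identified too.
  subst (λ r → Star _ _ (u , r)) ([]=-irrelevant p q) ε

-- Every vertex reaches `a`: those of `W` inside `W`, and `b` by its edge to `a`. Two such walks,
-- one reversed, join at `a`.
extend-connected : (G : Graph (Fin n)) {W : Subset n} {a b : Fin n} →
  Connected (G [ W ]) → a ∈ W → Adj G a b → Connected (G [ W ∪ ⁅ b ⁆ ])
extend-connected G {W} {a} {b} conn a∈W ab x y =
  to-a x ◅◅ Star.reverse (adj-sym G) (to-a y)
  where
  include : W ⊆ W ∪ ⁅ b ⁆
  include = p⊆p∪q ⁅ b ⁆
  to-a : ∀ x → Star (Adj (G [ W ∪ ⁅ b ⁆ ])) x (a , include a∈W)
  to-a (x , p) with x∈p∪q⁻ W ⁅ b ⁆ p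
  ... | inj₁ x∈W = subst (λ r → Star _ (x , r) _) ([]=-irrelevant (include x∈W) p)
        (Star.gmap (λ (z , z∈W) → z , include z∈W) id (conn (x , x∈W) (a , a∈W)))
  ... | inj₂ x∈b with refl ← x∈⁅y⁆⇒x≡y b x∈b = adj-sym G ab ◅ ε

connected-subset : (G : Graph (Fin n)) {U : Subset n} → Connected (G [ U ]) →
  ∀ k → suc k ≤ ∣ U ∣ → ∃[ W ] (W ⊆ U × ∣ W ∣ ≡ suc k × Connected (G [ W ]))
connected-subset G {U} conn zero 1≤U =
  let u , u∈U = 0<∣p∣⇒Nonempty 1≤U in
  ⁅ u ⁆ , (λ x∈u → subst (_∈ U) (sym (x∈⁅y⁆⇒x≡y u x∈u)) u∈U) , ∣⁅x⁆∣≡1 u ,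
  ∣U∣≤1⇒connected G (ℕ.≤-reflexive (∣⁅x⁆∣≡1 u))
connected-subset G {U} conn (suc k) k<U
  with W , W⊆U , W≡ , connW ← connected-subset G conn k (ℕ.<⇒≤ k<U)
  with w , w∈W ← 0<∣p∣⇒Nonempty {p = W} (subst (0 <_) (sym W≡) z<s)
  with v , v∈U , v∉W ← ∣p∣<∣q∣⇒∃∈q∖p {p = W} {U} (subst (_< ∣ U ∣) (sym W≡) k<U)
  -- A walk in `U` from `w` to the missed vertex `v` must leave `W`; the far end `b` of the exit
  -- edge is the vertex to add, rather than `v` itself.
  with a , b , a∈W , b∈U , b∉W , ab ← crossing-edge G {W = W} (conn (w , W⊆U w∈W) (v , v∈U)) w∈W v∉W
  = W ∪ ⁅ b ⁆ , ⊆U , trans (∣p∪⁅x⁆∣≡1+∣p∣ b∉W) (cong suc W≡) , extend-connected G connW a∈W ab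
  where
  ⊆U : W ∪ ⁅ b ⁆ ⊆ U
  ⊆U x∈ with x∈p∪q⁻ W ⁅ b ⁆ x∈
  ... | inj₁ x∈W = W⊆U x∈W
  ... | inj₂ x∈b = subst (_∈ U) (sym (x∈⁅y⁆⇒x≡y b x∈b)) b∈U

-- Sizes and numbers of ocd-sets.

module _ (G : Graph (Fin n)) where

  ⊤-isOCDSet : IsOCDSet G ⊤
  ⊤-isOCDSet = (λ v v∉⊤ → contradiction ∈⊤ v∉⊤) , inj₁ refl

  dominating-⊆ : {S T : Subset n} → S ⊆ T → IsDominating G S → IsDominating G T
  dominating-⊆ S⊆T dom v v∉T = let u , u∈S , vu = dom v (v∉T ∘ S⊆T) in u , S⊆T u∈S , vu

  ∈-ocdSets : {S : Subset n} → IsOCDSet G S → S List.∈ ocdSets G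
  ∈-ocdSets {S} ocd = List.∈-filter⁺ (isOCDSet? G) (∈-subsets S) ocd

  γ̃≤∣S∣ : {S : Subset n} → IsOCDSet G S → γ̃ G ≤ ∣ S ∣
  γ̃≤∣S∣ ocd = min≤v⁺ n _ (inj₂ (List.lose (List.∈-map⁺ ∣_∣ (∈-ocdSets ocd)) ℕ.≤-refl))

  γ̃-attained : ∃[ S ] (IsOCDSet G S × ∣ S ∣ ≡ γ̃ G)
  γ̃-attained with argmin-sel id n (map ∣_∣ (ocdSets G))
  -- The default value `n` of `min` is the size of the full vertex set.
  ... | inj₁ γ≡n = ⊤ , ⊤-isOCDSet , trans (∣⊤∣≡n n) (sym γ≡n)
  ... | inj₂ γ∈  =
    let S , S∈ , γ≡ = List.∈-map⁻ ∣_∣ γ∈ in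
    S , proj₂ (List.∈-filter⁻ (isOCDSet? G) {xs = subsets n} S∈) , sym γ≡

  γ̃≤n : γ̃ G ≤ n
  γ̃≤n = subst (γ̃ G ≤_) (∣⊤∣≡n n) (γ̃≤∣S∣ ⊤-isOCDSet)

  -- As the vertex set is nonempty, some vertex has to be dominated, which the empty set cannot do.
  0<γ̃ : .{{NonZero n}} → 0 < γ̃ G
  0<γ̃ with S , (dom , _) , S≡γ ← γ̃-attained with Fin.any? (_∈? S)
  ... | yes (_ , x∈S) = subst (0 <_) S≡γ (x∈p⇒0<∣p∣ x∈S)
  ... | no  S-empty   =
    let v = fromℕ< (>-nonZero⁻¹ n)
        u , u∈S , _ = dom v λ v∈S → S-empty (v , v∈S)
    in contradiction (u , u∈S) S-empty

  -- The split is on `n ∸ i`, the size that the complement must have. If it is positive, the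
  -- complement is cut out of the connected complement of a minimum ocd-set.
  ocdSet-of-size : ∀ {i} → γ̃ G ≤ i → i ≤ n → ∃[ S ] (IsOCDSet G S × ∣ S ∣ ≡ i)
  ocdSet-of-size {i} γ≤i i≤n with n ∸ i in n∸i≡
  ... | zero  = ⊤ , ⊤-isOCDSet , trans (∣⊤∣≡n n) (ℕ.≤-antisym (ℕ.m∸n≡0⇒m≤n n∸i≡) i≤n)
  ... | suc k with γ̃-attained
  -- A minimum ocd-set equal to `⊤` would force `n ≤ i`, against `n ∸ i` being a successor.
  ...   | S , (dom , inj₁ refl) , S≡γ =
    contradiction (trans (sym n∸i≡) (ℕ.m≤n⇒m∸n≡0 (ℕ.≤-trans (ℕ.≤-reflexive (trans (sym (∣⊤∣≡n n)) S≡γ)) γ≤i))) λ ()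
  ...   | S , (dom , inj₂ conn) , S≡γ
    -- From `∣ S ∣ ≤ i`, the set `∁ S` has at least `n ∸ i` vertices, enough for a connected part of
    -- that size.
    with W , W⊆∁S , W≡ , connW ← connected-subset G {∁ S} conn k
           (subst₂ _≤_ n∸i≡ (sym (∣∁p∣≡n∸∣p∣ S)) (ℕ.∸-monoʳ-≤ n (subst (_≤ i) (sym S≡γ) γ≤i)))
    = ∁ W , (dominating-⊆ S⊆∁W dom , inj₂ (subst (Connected ∘ (G [_])) (sym (¬-involutive W)) connW)) , (begin
      ∣ ∁ W ∣       ≡⟨ ∣∁p∣≡n∸∣p∣ W ⟩
      n ∸ ∣ W ∣     ≡⟨ cong (n ∸_) (trans W≡ (sym n∸i≡)) ⟩
      n ∸ (n ∸ i)   ≡⟨ ℕ.m∸[m∸n]≡n i≤n ⟩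
      i             ∎)
    where
    open ≡-Reasoning
    open BooleanAlgebra (∪-∩-booleanAlgebra n) using (¬-involutive)
    S⊆∁W : S ⊆ ∁ W
    S⊆∁W x∈S = x∉p⇒x∈∁p λ x∈W → x∈∁p⇒x∉p (W⊆∁S x∈W) x∈S

  d̃≡0⇒no-ocdSet : ∀ {i} → d̃ G i ≡ 0 → ∀ {S} → IsOCDSet G S → ∣ S ∣ ≢ i
  d̃≡0⇒no-ocdSet {i} d≡0 {S} ocd S≡i =
    ℕ.<⇒≢ (List.filter-some (λ S → ∣ S ∣ ℕ.≟ i) (List.lose (∈-ocdSets ocd) S≡i)) (sym d≡0)

  no-ocdSet⇒d̃≡0 : ∀ {i} → (∀ {S} → IsOCDSet G S → ∣ S ∣ ≢ i) → d̃ G i ≡ 0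
  no-ocdSet⇒d̃≡0 {i} none = cong length (List.filter-none (λ S → ∣ S ∣ ℕ.≟ i)
    (All.map none (All.all-filter (isOCDSet? G) (subsets n))))

  d̃≢0 : ∀ {i} → γ̃ G ≤ i → i ≤ n → d̃ G i ≢ 0
  d̃≢0 γ≤i i≤n d≡0 = let S , ocd , S≡i = ocdSet-of-size γ≤i i≤n in d̃≡0⇒no-ocdSet d≡0 ocd S≡i

  d̃≡0⇒outside-range : ∀ {i} → d̃ G i ≡ 0 → i < γ̃ G ⊎ n < i
  d̃≡0⇒outside-range {i} d≡0 with i ℕ.<? γ̃ G | n ℕ.<? i
  ... | yes i<γ | _       = inj₁ i<γ
  ... | no _    | yes n<i = inj₂ n<i
  ... | no i≮γ  | no n≮i  = contradiction d≡0 (d̃≢0 (ℕ.≮⇒≥ i≮γ) (ℕ.≮⇒≥ n≮i))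

  outside-range⇒d̃≡0 : ∀ {i} → i < γ̃ G ⊎ n < i → d̃ G i ≡ 0
  outside-range⇒d̃≡0 (inj₁ i<γ) = no-ocdSet⇒d̃≡0 λ ocd S≡i → ℕ.<⇒≱ i<γ (subst (γ̃ G ≤_) S≡i (γ̃≤∣S∣ ocd))
  outside-range⇒d̃≡0 (inj₂ n<i) = no-ocdSet⇒d̃≡0 λ {S} _ S≡i → ℕ.<⇒≱ n<i (subst (_≤ n) S≡i (∣p∣≤n S))

  -- The ocd test rejects no set of size `i`, so the count runs over all subsets of that size.
  d̃≡nCi : ∀ {i} → (∀ {S} → ∣ S ∣ ≡ i → IsOCDSet G S) → d̃ G i ≡ n C i
  d̃≡nCi {i} all-ocd = trans
    (cong length (filter-filter (isOCDSet? G) (λ S → ∣ S ∣ ℕ.≟ i) all-ocd (subsets n)))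
    (#subsets≡nCk n i)

  d̃[n]≡1 : d̃ G n ≡ 1
  d̃[n]≡1 = trans (d̃≡nCi λ S≡n → subst (IsOCDSet G) (sym (∣p∣≡n⇒p≡⊤ S≡n)) ⊤-isOCDSet) (nCn≡1 n)

  has-neighbour : {u v : Fin n} → Star (Adj G) v u → u ≢ v → ∃[ w ] Adj G v w
  has-neighbour ε       u≢v = contradiction refl u≢v
  has-neighbour (e ◅ _) _   = _ , e

  -- The complement is a single vertex, so only domination is at stake. For `n = 1` the equation
  -- fails: the empty set is not dominating and the count is 0.
  d̃[n∸1]≡n : Connected G → 2 ≤ n → d̃ G (n ∸ 1) ≡ n
  d̃[n∸1]≡n conn 2≤n = begin
    d̃ G (n ∸ 1)       ≡⟨ d̃≡nCi ocd ⟩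
    n C (n ∸ 1)       ≡⟨ nCk≡nC[n∸k] (ℕ.m∸n≤m n 1) ⟩
    n C (n ∸ (n ∸ 1)) ≡⟨ cong (n C_) n∸[n∸1]≡1 ⟩
    n C 1             ≡⟨ nC1≡n n ⟩
    n                 ∎
    where
    open ≡-Reasoning
    n∸[n∸1]≡1 : n ∸ (n ∸ 1) ≡ 1
    n∸[n∸1]≡1 = ℕ.m∸[m∸n]≡n (ℕ.<⇒≤ 2≤n)
    ocd : ∀ {S} → ∣ S ∣ ≡ n ∸ 1 → IsOCDSet G S
    ocd {S} S≡ = dom , inj₂ (∣U∣≤1⇒connected G ∁S≤1)
      where
      ∁S≤1 : ∣ ∁ S ∣ ≤ 1
      ∁S≤1 = ℕ.≤-reflexive (trans (∣∁p∣≡n∸∣p∣ S) (trans (cong (n ∸_) S≡) n∸[n∸1]≡1))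
      dom : IsDominating G S
      dom v v∉S
        -- From `2 ≤ n`, the set `S` has a vertex; it differs from `v`, so a walk to it starts with
        -- an edge at `v`.
        with s , s∈S ← 0<∣p∣⇒Nonempty {p = S} (subst (0 <_) (sym S≡) (ℕ.∸-monoˡ-≤ 1 2≤n))
        with w , vw ← has-neighbour (conn v s) (λ { refl → v∉S s∈S })
        -- Outside `S` there is only `v`, so `w` outside `S` would make `vw` a loop.
        = w , decidable-stable (w ∈? S) (λ w∉S →
            irrefl G (∣p∣≤1⇒≡ ∁S≤1 (x∉p⇒x∈∁p v∉S) (x∉p⇒x∈∁p w∉S)) vw) , vw

-- Adding edges preserves domination and connectedness, so a minimum ocd-set of `H` is an ocd-set of
-- `G`.
γ̃-spanning : (G H : Graph (Fin n)) → H IsSpanningSubgraphOf G → γ̃ G ≤ γ̃ H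
γ̃-spanning G H H⊆G with S , (dom , conn) , S≡γ ← γ̃-attained H =
  subst (γ̃ G ≤_) S≡γ (γ̃≤∣S∣ G (dom′ , conn′ conn))
  where
  dom′ : IsDominating G S
  dom′ v v∉S = let u , u∈S , vu = dom v v∉S in u , u∈S , H⊆G v u vu
  conn′ : S ≡ ⊤ ⊎ Connected (H [ ∁ S ]) → S ≡ ⊤ ⊎ Connected (G [ ∁ S ])
  conn′ (inj₁ S≡⊤) = inj₁ S≡⊤
  conn′ (inj₂ c)   = inj₂ λ u v → Star.map (H⊆G _ _) (c u v)

-- Coefficients of polynomials and of sums of monomials.

coeff-+ₚ : ∀ p q k → coeff (p +ₚ q) k ≡ coeff p k ℤ.+ coeff q k
coeff-+ₚ []      q       k       = sym (ℤ.+-identityˡ (coeff q k))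
coeff-+ₚ (a ∷ p) []      k       = sym (ℤ.+-identityʳ (coeff (a ∷ p) k))
coeff-+ₚ (a ∷ p) (b ∷ q) zero    = refl
coeff-+ₚ (a ∷ p) (b ∷ q) (suc k) = coeff-+ₚ p q k

coeff-map : ∀ a q k → coeff (map (a ℤ.*_) q) k ≡ a ℤ.* coeff q k
coeff-map a []      k       = sym (ℤ.*-zeroʳ a)
coeff-map a (b ∷ q) zero    = refl
coeff-map a (b ∷ q) (suc k) = coeff-map a q k

-- `drop m p` later serves as the quotient of `p` by the `m`-th power of X.
coeff-drop : ∀ m p k → coeff (drop m p) k ≡ coeff p (m + k)
coeff-drop zero    p       k = refl
coeff-drop (suc m) []      k = refl
coeff-drop (suc m) (a ∷ p) k = coeff-drop m p k

-- This places every nonzero coefficient in the range that `deg` searches.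
coeff≢0⇒<length : ∀ p {k} → coeff p k ≢ 0ℤ → k < length p
coeff≢0⇒<length []      c≢0         = contradiction refl c≢0
coeff≢0⇒<length (a ∷ p) {zero}  c≢0 = z<s
coeff≢0⇒<length (a ∷ p) {suc k} c≢0 = s≤s (coeff≢0⇒<length p c≢0)

coeff-monomial-≡ : ∀ c i → coeff (monomial c i) i ≡ c
coeff-monomial-≡ c zero    = refl
coeff-monomial-≡ c (suc i) = coeff-monomial-≡ c i

coeff-monomial-≢ : ∀ c {i k} → i ≢ k → coeff (monomial c i) k ≡ 0ℤ
coeff-monomial-≢ c {zero}  {zero}  i≢k = contradiction refl i≢k
coeff-monomial-≢ c {zero}  {suc k} i≢k = refl
coeff-monomial-≢ c {suc i} {zero}  i≢k = refl
coeff-monomial-≢ c {suc i} {suc k} i≢k = coeff-monomial-≢ c (i≢k ∘ cong suc)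

module _ (c : ℕ → ℤ) where

  private
    -- The exponent is taken along a function so that the tail of applyUpTo is
    -- again of the same form.
    sumFrom : (ℕ → ℕ) → ℕ → Poly
    sumFrom e m = foldr _+ₚ_ [] (applyUpTo (λ j → monomial (c (e j)) (e j)) m)

  coeff-sum-absent : ∀ e m {k} → (∀ j → j < m → e j ≢ k) → coeff (sumFrom e m) k ≡ 0ℤ
  coeff-sum-absent e zero    e≢k = refl
  coeff-sum-absent e (suc m) {k} e≢k = trans (coeff-+ₚ (monomial _ (e 0)) _ k)
    (cong₂ ℤ._+_ (coeff-monomial-≢ _ (e≢k 0 z<s))
                 (coeff-sum-absent (e ∘ suc) m λ j j<m → e≢k (suc j) (s≤s j<m)))

  -- Injectivity of `e` leaves a single summand with exponent `e j`.
  coeff-sum-present : ∀ e m j → (∀ {i j} → e i ≡ e j → i ≡ j) → j < m →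
    coeff (sumFrom e m) (e j) ≡ c (e j)
  coeff-sum-present e (suc m) zero inj j<m = begin
    coeff (sumFrom e (suc m)) (e 0)
      ≡⟨ coeff-+ₚ (monomial _ (e 0)) _ (e 0) ⟩
    coeff (monomial (c (e 0)) (e 0)) (e 0) ℤ.+ coeff (sumFrom (e ∘ suc) m) (e 0)
      ≡⟨ cong₂ ℤ._+_ (coeff-monomial-≡ _ (e 0)) (coeff-sum-absent (e ∘ suc) m λ j _ eq → ℕ.1+n≢0 (inj eq)) ⟩
    c (e 0) ℤ.+ 0ℤ
      ≡⟨ ℤ.+-identityʳ _ ⟩
    c (e 0) ∎
    where open ≡-Reasoning
  coeff-sum-present e (suc m) (suc j) inj j<m = begin
    coeff (sumFrom e (suc m)) (e (suc j))
      ≡⟨ coeff-+ₚ (monomial _ (e 0)) _ (e (suc j)) ⟩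
    coeff (monomial (c (e 0)) (e 0)) (e (suc j)) ℤ.+ coeff (sumFrom (e ∘ suc) m) (e (suc j))
      ≡⟨ cong₂ ℤ._+_ (coeff-monomial-≢ _ (λ eq → ℕ.0≢1+n (inj eq)))
                     (coeff-sum-present (e ∘ suc) m j (ℕ.suc-injective ∘ inj) (s≤s⁻¹ j<m)) ⟩
    0ℤ ℤ.+ c (e (suc j))
      ≡⟨ ℤ.+-identityˡ _ ⟩
    c (e (suc j)) ∎
    where open ≡-Reasoning

  -- Cutting the sum off loses nothing, since `c` vanishes outside the range; inside it, exponent
  -- `k` comes from index `k ∸ a`.
  coeff-sumₚ : ∀ a b → (∀ {k} → k < a ⊎ b < k → c k ≡ 0ℤ) →
    ∀ k → coeff (sumₚ a b λ i → monomial (c i) i) k ≡ c k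
  coeff-sumₚ a b c≡0 k with k ℕ.<? a | b ℕ.<? k
  ... | yes k<a | _ = trans
    (coeff-sum-absent (a +_) (suc b ∸ a) λ j _ eq → ℕ.<⇒≱ k<a (subst (a ≤_) eq (ℕ.m≤m+n a j)))
    (sym (c≡0 (inj₁ k<a)))
  ... | no _ | yes b<k = trans
    (coeff-sum-absent (a +_) (suc b ∸ a) λ j j< eq → ℕ.<⇒≱ (subst (_< suc b) eq (bound j j<)) b<k)
    (sym (c≡0 (inj₂ b<k)))
    where
    bound : ∀ j → j < suc b ∸ a → a + j < suc b
    -- An index below `suc b ∸ a` exists only if the subtraction is not truncated.
    bound j j< = subst (_< suc b) (ℕ.+-comm j a)
      (ℕ.m≤o∸n⇒m+n≤o (suc j) (ℕ.<⇒≤ (ℕ.m∸n≢0⇒n<m {suc b} {a} (ℕ.m<n⇒n≢0 j<))) j<)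
  ... | no k≮a | no b≮k = subst (λ k → coeff (sumFrom (a +_) (suc b ∸ a)) k ≡ c k) (ℕ.m+[n∸m]≡n a≤k)
    (coeff-sum-present (a +_) (suc b ∸ a) (k ∸ a) (ℕ.+-cancelˡ-≡ a _ _)
      (ℕ.∸-monoˡ-< (s≤s (ℕ.≮⇒≥ b≮k)) a≤k))
    where a≤k = ℕ.≮⇒≥ k≮a

-- Multiplication by powers of X and the root zero.

-- Equal polynomials may be lists of different lengths; this handles the leftover zeros in
-- `*ₚ-congˡ`.
*ₚ-zeroˡ : ∀ p q → p ≈ₚ [] → p *ₚ q ≈ₚ []
*ₚ-zeroˡ []      q p≈0 k = refl
*ₚ-zeroˡ (a ∷ p) q p≈0 k = trans (coeff-+ₚ (map (a ℤ.*_) q) _ k) (cong₂ ℤ._+_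
  (trans (coeff-map a q k) (cong (ℤ._* coeff q k) (p≈0 0)))
  (tail k))
  where
  tail : ∀ k → coeff (0ℤ ∷ p *ₚ q) k ≡ 0ℤ
  tail zero    = refl
  tail (suc k) = *ₚ-zeroˡ p q (p≈0 ∘ suc) k

*ₚ-congˡ : ∀ p p′ q → p ≈ₚ p′ → p *ₚ q ≈ₚ p′ *ₚ q
*ₚ-congˡ []      p′        q p≈ k = sym (*ₚ-zeroˡ p′ q (sym ∘ p≈) k)
*ₚ-congˡ (a ∷ p) []        q p≈ k = *ₚ-zeroˡ (a ∷ p) q p≈ k
*ₚ-congˡ (a ∷ p) (a′ ∷ p′) q p≈ k = begin
  coeff (map (a ℤ.*_) q +ₚ (0ℤ ∷ p *ₚ q)) k            ≡⟨ coeff-+ₚ (map (a ℤ.*_) q) _ k ⟩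
  coeff (map (a ℤ.*_) q) k ℤ.+ coeff (0ℤ ∷ p *ₚ q) k    ≡⟨ cong₂ ℤ._+_ (cong (λ a → coeff (map (a ℤ.*_) q) k) (p≈ 0)) (tail k) ⟩
  coeff (map (a′ ℤ.*_) q) k ℤ.+ coeff (0ℤ ∷ p′ *ₚ q) k  ≡⟨ coeff-+ₚ (map (a′ ℤ.*_) q) _ k ⟨
  coeff (map (a′ ℤ.*_) q +ₚ (0ℤ ∷ p′ *ₚ q)) k          ∎
  where
  open ≡-Reasoning
  tail : ∀ k → coeff (0ℤ ∷ p *ₚ q) k ≡ coeff (0ℤ ∷ p′ *ₚ q) k
  tail zero    = refl
  tail (suc k) = *ₚ-congˡ p p′ q (p≈ ∘ suc) k

0∷-*ₚ : ∀ p q → (0ℤ ∷ p) *ₚ q ≈ₚ 0ℤ ∷ p *ₚ q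
0∷-*ₚ p q k = trans (coeff-+ₚ (map (0ℤ ℤ.*_) q) _ k)
  (trans (cong (ℤ._+ coeff (0ℤ ∷ p *ₚ q) k) (coeff-map 0ℤ q k)) (ℤ.+-identityˡ _))

*ₚ-identityˡ : ∀ q → (1ℤ ∷ []) *ₚ q ≈ₚ q
*ₚ-identityˡ q k = begin
  coeff (map (1ℤ ℤ.*_) q +ₚ (0ℤ ∷ [])) k           ≡⟨ coeff-+ₚ (map (1ℤ ℤ.*_) q) _ k ⟩
  coeff (map (1ℤ ℤ.*_) q) k ℤ.+ coeff (0ℤ ∷ []) k  ≡⟨ cong₂ ℤ._+_ (trans (coeff-map 1ℤ q k) (ℤ.*-identityˡ _)) (zeros k) ⟩
  coeff q k ℤ.+ 0ℤ                                 ≡⟨ ℤ.+-identityʳ _ ⟩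
  coeff q k                                        ∎
  where
  open ≡-Reasoning
  zeros : ∀ k → coeff (0ℤ ∷ []) k ≡ 0ℤ
  zeros zero    = refl
  zeros (suc k) = refl

-- `X- 0ℤ` computes to `0ℤ ∷ 1ℤ ∷ []`, so multiplying by it shifts coefficients.
X-0*ₚ : ∀ q → (X- 0ℤ) *ₚ q ≈ₚ 0ℤ ∷ q
X-0*ₚ q k = trans (0∷-*ₚ (1ℤ ∷ []) q k) (tail k)
  where
  tail : ∀ k → coeff (0ℤ ∷ (1ℤ ∷ []) *ₚ q) k ≡ coeff (0ℤ ∷ q) k
  tail zero    = refl
  tail (suc k) = *ₚ-identityˡ q k

-- Rewriting the left factor as a shifted list takes the place of associativity of `*ₚ`.
X^[1+m]*ₚ : ∀ m r → (X- 0ℤ) ^ₚ suc m *ₚ r ≈ₚ 0ℤ ∷ ((X- 0ℤ) ^ₚ m *ₚ r)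
X^[1+m]*ₚ m r k = trans
  (*ₚ-congˡ ((X- 0ℤ) ^ₚ suc m) (0ℤ ∷ (X- 0ℤ) ^ₚ m) r (X-0*ₚ ((X- 0ℤ) ^ₚ m)) k)
  (0∷-*ₚ ((X- 0ℤ) ^ₚ m) r k)

coeff-X^m*ₚ-low : ∀ m r {k} → k < m → coeff ((X- 0ℤ) ^ₚ m *ₚ r) k ≡ 0ℤ
coeff-X^m*ₚ-low (suc m) r {zero}  k<m = X^[1+m]*ₚ m r 0
coeff-X^m*ₚ-low (suc m) r {suc k} k<m = trans (X^[1+m]*ₚ m r (suc k)) (coeff-X^m*ₚ-low m r (s≤s⁻¹ k<m))

coeff-X^m*ₚ-shift : ∀ m r k → coeff ((X- 0ℤ) ^ₚ m *ₚ r) (m + k) ≡ coeff r k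
coeff-X^m*ₚ-shift zero    r k = *ₚ-identityˡ r k
coeff-X^m*ₚ-shift (suc m) r k = trans (X^[1+m]*ₚ m r (suc (m + k))) (coeff-X^m*ₚ-shift m r k)

eval-0 : ∀ p → eval p 0ℤ ≡ coeff p 0
eval-0 []      = refl
eval-0 (a ∷ p) = ℤ.+-identityʳ a

-- The vanishing low coefficients let the power of X be split off; one more factor X would also kill
-- coefficient `m`.
0-isRootWithMultiplicity : ∀ p {m} → 0 < m → (∀ {k} → k < m → coeff p k ≡ 0ℤ) → coeff p m ≢ 0ℤ →
  IsRootWithMultiplicity p 0ℤ m
0-isRootWithMultiplicity p {m} 0<m low c≢0 = record
  { isRoot     = trans (eval-0 p) (low 0<m)
  ; divides    = drop m p , factor
  ; notDivides = λ (r , p≈) → c≢0 (trans (p≈ m) (coeff-X^m*ₚ-low (suc m) r ℕ.≤-refl))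
  }
  where
  factor : p ≈ₚ (X- 0ℤ) ^ₚ m *ₚ drop m p
  factor k with k ℕ.<? m
  ... | yes k<m = trans (low k<m) (sym (coeff-X^m*ₚ-low m (drop m p) k<m))
  ... | no  k≮m = subst (λ k → coeff p k ≡ coeff ((X- 0ℤ) ^ₚ m *ₚ drop m p) k) (ℕ.m+[n∸m]≡n (ℕ.≮⇒≥ k≮m))
    (sym (trans (coeff-X^m*ₚ-shift m (drop m p) (k ∸ m)) (coeff-drop m p (k ∸ m))))

-- Monotonicity of polynomials with nonnegative coefficients.

NonNegCoeffs : Poly → Set
NonNegCoeffs p = ∀ k → 0ℤ ℤ.≤ coeff p k

-- The same Horner scheme as `evalᵣ`, so real evaluation is rational evaluation at each index and
-- all estimates take place in `ℚ`.
evalℚ : Poly → ℚ → ℚ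
evalℚ p x = foldr (λ a y → a ℚ./ 1 ℚ.+ x ℚ.* y) (0ℤ ℚ./ 1) p

seq-evalᵣ : ∀ p x i → seq (evalᵣ p x) i ≡ evalℚ p (seq x i)
seq-evalᵣ []      x i = refl
seq-evalᵣ (a ∷ p) x i = cong (λ y → a ℚ./ 1 ℚ.+ seq x i ℚ.* y) (seq-evalᵣ p x i)

/1-nonNeg : ∀ {a} → 0ℤ ℤ.≤ a → 0ℚ ℚ.≤ a ℚ./ 1
/1-nonNeg (ℤ.+≤+ {n = n} _) = ℚ.nonNegative⁻¹ (ℤ.+ n ℚ./ 1) {{ℚ.normalize-nonNeg n 1}}

/1-pos : ∀ {a} → 0ℤ ℤ.< a → 0ℚ ℚ.< a ℚ./ 1
/1-pos (ℤ.+<+ {n = suc n} _) = ℚ.positive⁻¹ (ℤ.+ suc n ℚ./ 1) {{ℚ.normalize-pos (suc n) 1}}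

*-nonNeg : ∀ {x y} → 0ℚ ℚ.≤ x → 0ℚ ℚ.≤ y → 0ℚ ℚ.≤ x ℚ.* y
*-nonNeg {x} {y} 0≤x 0≤y = subst (ℚ._≤ x ℚ.* y) (ℚ.*-zeroʳ x) (ℚ.*-monoˡ-≤-nonNeg x {{ℚ.nonNegative 0≤x}} 0≤y)

*-pos : ∀ {x y} → 0ℚ ℚ.< x → 0ℚ ℚ.< y → 0ℚ ℚ.< x ℚ.* y
*-pos {x} {y} 0<x 0<y = subst (ℚ._< x ℚ.* y) (ℚ.*-zeroʳ x) (ℚ.*-monoʳ-<-pos x {{ℚ.positive 0<x}} 0<y)

*-mono-≤-nonNeg : ∀ {x y u v} → 0ℚ ℚ.≤ y → 0ℚ ℚ.≤ u → x ℚ.≤ y → u ℚ.≤ v → x ℚ.* u ℚ.≤ y ℚ.* v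
*-mono-≤-nonNeg {x} {y} {u} {v} 0≤y 0≤u x≤y u≤v = ℚ.≤-trans
  (ℚ.*-monoʳ-≤-nonNeg u {{ℚ.nonNegative 0≤u}} x≤y)
  (ℚ.*-monoˡ-≤-nonNeg y {{ℚ.nonNegative 0≤y}} u≤v)

evalℚ-nonNeg : ∀ p → NonNegCoeffs p → ∀ {x} → 0ℚ ℚ.≤ x → 0ℚ ℚ.≤ evalℚ p x
evalℚ-nonNeg []      p≥0 0≤x = ℚ.≤-refl
evalℚ-nonNeg (a ∷ p) p≥0 0≤x =
  ℚ.+-mono-≤ (/1-nonNeg (p≥0 0)) (*-nonNeg 0≤x (evalℚ-nonNeg p (p≥0 ∘ suc) 0≤x))

evalℚ-mono : ∀ p → NonNegCoeffs p → ∀ {x y} → 0ℚ ℚ.≤ x → x ℚ.≤ y → evalℚ p x ℚ.≤ evalℚ p y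
evalℚ-mono []      p≥0 0≤x x≤y = ℚ.≤-refl
evalℚ-mono (a ∷ p) p≥0 0≤x x≤y = ℚ.+-monoʳ-≤ (a ℚ./ 1)
  (*-mono-≤-nonNeg (ℚ.≤-trans 0≤x x≤y) (evalℚ-nonNeg p (p≥0 ∘ suc) 0≤x) x≤y (evalℚ-mono p (p≥0 ∘ suc) 0≤x x≤y))

evalℚ-pos : ∀ p → NonNegCoeffs p → ∀ k → 0ℤ ℤ.< coeff p k → ∀ {x} → 0ℚ ℚ.< x → 0ℚ ℚ.< evalℚ p x
evalℚ-pos []      p≥0 k       pₖ>0 0<x = contradiction pₖ>0 (ℤ.<-irrefl refl)
evalℚ-pos (a ∷ p) p≥0 zero    pₖ>0 0<x =
  ℚ.+-mono-<-≤ (/1-pos pₖ>0) (*-nonNeg (ℚ.<⇒≤ 0<x) (evalℚ-nonNeg p (p≥0 ∘ suc) (ℚ.<⇒≤ 0<x)))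
evalℚ-pos (a ∷ p) p≥0 (suc k) pₖ>0 0<x =
  ℚ.+-mono-≤-< (/1-nonNeg (p≥0 0)) (*-pos 0<x (evalℚ-pos p (p≥0 ∘ suc) k pₖ>0 0<x))

-- With p = a + X q, the increment p(y) - p(x) is at least (y - x) q(y).
evalℚ-gap : ∀ p → NonNegCoeffs p → ∀ k → 0ℤ ℤ.< coeff p (suc k) → ∀ {c e} → 0ℚ ℚ.< c → 0ℚ ℚ.< e →
  ∃[ δ ] (0ℚ ℚ.< δ × (∀ {x y} → c ℚ.≤ x → x ℚ.+ e ℚ.≤ y → evalℚ p x ℚ.+ δ ℚ.≤ evalℚ p y))
evalℚ-gap []      p≥0 k pₖ>0 0<c 0<e = contradiction pₖ>0 (ℤ.<-irrefl refl)
evalℚ-gap (a ∷ q) p≥0 k pₖ>0 {c} {e} 0<c 0<e =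
  -- The gap is uniform in `x` and `y`, because `y - x` is at least `e` and `q(y)` is at least
  -- `q(c)`.
  e ℚ.* evalℚ q c , *-pos 0<e (evalℚ-pos q q≥0 k pₖ>0 0<c) , λ {x} {y} c≤x x+e≤y →
    let 0≤c = ℚ.<⇒≤ 0<c
        0≤x = ℚ.≤-trans 0≤c c≤x
        x≤y = ℚ.≤-trans (ℚ.≤-trans (ℚ.≤-reflexive (sym (ℚ.+-identityʳ x))) (ℚ.+-monoʳ-≤ x (ℚ.<⇒≤ 0<e))) x+e≤y
        0≤y = ℚ.≤-trans 0≤x x≤y
    in begin
    a ℚ./ 1 ℚ.+ x ℚ.* evalℚ q x ℚ.+ e ℚ.* evalℚ q c
      ≡⟨ ℚ.+-assoc (a ℚ./ 1) _ _ ⟩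
    a ℚ./ 1 ℚ.+ (x ℚ.* evalℚ q x ℚ.+ e ℚ.* evalℚ q c)
      ≤⟨ ℚ.+-monoʳ-≤ (a ℚ./ 1) (ℚ.+-mono-≤
           (*-mono-≤-nonNeg 0≤x (evalℚ-nonNeg q q≥0 0≤x) ℚ.≤-refl (evalℚ-mono q q≥0 0≤x x≤y))
           (*-mono-≤-nonNeg (ℚ.<⇒≤ 0<e) (evalℚ-nonNeg q q≥0 0≤c) ℚ.≤-refl (evalℚ-mono q q≥0 0≤c (ℚ.≤-trans c≤x x≤y)))) ⟩
    a ℚ./ 1 ℚ.+ (x ℚ.* evalℚ q y ℚ.+ e ℚ.* evalℚ q y)
      ≡⟨ cong (a ℚ./ 1 ℚ.+_) (ℚ.*-distribʳ-+ (evalℚ q y) x e) ⟨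
    a ℚ./ 1 ℚ.+ (x ℚ.+ e) ℚ.* evalℚ q y
      ≤⟨ ℚ.+-monoʳ-≤ (a ℚ./ 1) (*-mono-≤-nonNeg 0≤y (evalℚ-nonNeg q q≥0 0≤y) x+e≤y ℚ.≤-refl) ⟩
    a ℚ./ 1 ℚ.+ y ℚ.* evalℚ q y ∎
  where
  open ℚ.≤-Reasoning
  q≥0 : NonNegCoeffs q
  q≥0 = p≥0 ∘ suc

p≤∣p∣ : ∀ p → p ℚ.≤ ℚ.∣ p ∣
p≤∣p∣ p with ℚ.≤-total 0ℚ p
... | inj₁ 0≤p = ℚ.≤-reflexive (sym (ℚ.0≤p⇒∣p∣≡p 0≤p))
... | inj₂ p≤0 = ℚ.≤-trans p≤0 (ℚ.0≤∣p∣ p)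

∣p-q∣≤e⇒p≤e+q : ∀ p q {e} → ℚ.∣ p ℚ.- q ∣ ℚ.≤ e → p ℚ.≤ e ℚ.+ q
∣p-q∣≤e⇒p≤e+q p q {e} pq≤e = begin
  p                  ≡⟨ ℚ.+-identityʳ p ⟨
  p ℚ.+ 0ℚ           ≡⟨ cong (p ℚ.+_) (ℚ.+-inverseˡ q) ⟨
  p ℚ.+ (ℚ.- q ℚ.+ q) ≡⟨ ℚ.+-assoc p (ℚ.- q) q ⟨
  p ℚ.- q ℚ.+ q      ≤⟨ ℚ.+-monoˡ-≤ q (ℚ.≤-trans (p≤∣p∣ (p ℚ.- q)) pq≤e) ⟩
  e ℚ.+ q            ∎
  where open ℚ.≤-Reasoning

¼ : ℚ
¼ = ℤ.+ 1 ℚ./ 4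

-- The terms of a real at least 1 may lie below 1, but some positive lower bound holds eventually.
-- Beyond `N` all terms are within `¼` of term `N`. If that term is at least `½`, they are at least
-- `¼`; otherwise they stay below `1 - ¼`, making the real less than 1.
1≤x⇒eventually-¼≤ : ∀ x → fromℤ 1ℤ ≤ᵣ x → ∃[ N ] (∀ i → N ≤ i → ¼ ℚ.≤ seq x i)
1≤x⇒eventually-¼≤ x 1≤x with N , close ← cauchy x ¼ (ℚ.positive⁻¹ ¼) with ½ ℚ.≤? seq x N
... | yes ½≤xN = N , λ i N≤i → begin
  ¼                            ≡⟨⟩
  ℚ.- ¼ ℚ.+ ½                  ≤⟨ ℚ.+-monoʳ-≤ (ℚ.- ¼) (ℚ.≤-trans ½≤xN (∣p-q∣≤e⇒p≤e+q (seq x N) (seq x i) (close N i ℕ.≤-refl N≤i))) ⟩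
  ℚ.- ¼ ℚ.+ (¼ ℚ.+ seq x i)    ≡⟨ ℚ.+-assoc (ℚ.- ¼) ¼ (seq x i) ⟨
  0ℚ ℚ.+ seq x i               ≡⟨ ℚ.+-identityˡ (seq x i) ⟩
  seq x i                      ∎
  where open ℚ.≤-Reasoning
... | no ½≰xN = contradiction (¼ , ℚ.positive⁻¹ ¼ , N , λ i N≤i → begin
  seq x i ℚ.+ ¼                ≤⟨ ℚ.+-monoˡ-≤ ¼ (∣p-q∣≤e⇒p≤e+q (seq x i) (seq x N) (close i N N≤i ℕ.≤-refl)) ⟩
  ¼ ℚ.+ seq x N ℚ.+ ¼          ≤⟨ ℚ.+-monoˡ-≤ ¼ (ℚ.+-monoʳ-≤ ¼ (ℚ.<⇒≤ (ℚ.≰⇒> ½≰xN))) ⟩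
  ¼ ℚ.+ ½ ℚ.+ ¼                ≡⟨⟩
  1ℤ ℚ./ 1                     ∎) 1≤x
  where open ℚ.≤-Reasoning

-- Strict order of reals needs one gap for all late indices, which the uniform gap of `evalℚ-gap`
-- supplies.
evalᵣ-strictlyIncreasing : ∀ p → NonNegCoeffs p → ∀ k → 0ℤ ℤ.< coeff p (suc k) →
  StrictlyIncreasingOn (λ x → fromℤ 1ℤ ≤ᵣ x) (evalᵣ p)
evalᵣ-strictlyIncreasing p p≥0 k pₖ>0 x y 1≤x _ (e , 0<e , M , x+e≤y) =
  let N , ¼≤x = 1≤x⇒eventually-¼≤ x 1≤x
      δ , 0<δ , gap = evalℚ-gap p p≥0 k pₖ>0 (ℚ.positive⁻¹ ¼) 0<e
  in δ , 0<δ , M ⊔ N , λ i i≥ →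
    subst₂ (λ u v → u ℚ.+ δ ℚ.≤ v) (sym (seq-evalᵣ p x i)) (sym (seq-evalᵣ p y i))
      (gap (¼≤x i (ℕ.m⊔n≤o⇒n≤o M N i≥)) (x+e≤y i (ℕ.m⊔n≤o⇒m≤o M N i≥)))

-- Degrees and the coefficients of `D̃`.

induced-order-≤ : ∀ {m} {G : Graph (Fin n)} {H : Graph (Fin m)} → H IsInducedSubgraphOf G → m ≤ n
induced-order-≤ {H = H} (U , H≅G[U]) = Fin.injective⇒≤ {f = proj₁ ∘ Inverse.to bijection}
  λ {i} {j} eq → Injection.injective (↔⇒↣ bijection) (proj₁-injective eq)
  where
  open _≅_ H≅G[U] using (bijection)
  proj₁-injective : ∀ {u v : ∃[ x ] x ∈ U} → proj₁ u ≡ proj₁ v → u ≡ v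
  proj₁-injective {u , p} {.u , q} refl = cong (u ,_) ([]=-irrelevant p q)

deg-≥ : ∀ p {k} → coeff p k ≢ 0ℤ → k ≤ deg p
deg-≥ p c≢0 = v≤max⁺ 0 _ (inj₂ (List.lose
  (List.∈-filter⁺ (λ k → ¬? (coeff p k ℤ.≟ 0ℤ)) (List.∈-upTo⁺ (coeff≢0⇒<length p c≢0)) c≢0) ℕ.≤-refl))

deg-≤ : ∀ p {m} → (∀ {k} → m < k → coeff p k ≡ 0ℤ) → deg p ≤ m
deg-≤ p high = max≤v⁺ z≤n (All.map (λ c≢0 → ℕ.≮⇒≥ (c≢0 ∘ high))
  (All.all-filter (λ k → ¬? (coeff p k ℤ.≟ 0ℤ)) (upTo (length p))))

module _ (G : Graph (Fin n)) where

  coeff-D̃ : ∀ k → coeff (D̃ G) k ≡ ℤ.+ d̃ G k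
  coeff-D̃ = coeff-sumₚ (λ i → ℤ.+ d̃ G i) (γ̃ G) n
    (cong ℤ.+_ ∘ outside-range⇒d̃≡0 G)

  coeff-D̃≡0 : ∀ {k} → k < γ̃ G ⊎ n < k → coeff (D̃ G) k ≡ 0ℤ
  coeff-D̃≡0 {k} out = trans (coeff-D̃ k) (cong ℤ.+_ (outside-range⇒d̃≡0 G out))

  coeff-D̃≢0 : ∀ {k} → γ̃ G ≤ k → k ≤ n → coeff (D̃ G) k ≢ 0ℤ
  coeff-D̃≢0 {k} γ≤k k≤n c≡0 = d̃≢0 G γ≤k k≤n (ℤ.+-injective (trans (sym (coeff-D̃ k)) c≡0))

  D̃-nonNegCoeffs : NonNegCoeffs (D̃ G)
  D̃-nonNegCoeffs k = subst (0ℤ ℤ.≤_) (sym (coeff-D̃ k)) (ℤ.+≤+ z≤n)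

  -- The degree is the order of the graph, so degrees of induced subgraphs compare as their orders
  -- do.
  deg-D̃ : deg (D̃ G) ≡ n
  deg-D̃ = ℕ.≤-antisym
    (deg-≤ (D̃ G) (coeff-D̃≡0 ∘ inj₂))
    (deg-≥ (D̃ G) (coeff-D̃≢0 (γ̃≤n G) ℕ.≤-refl))

D̃-strictlyIncreasing : .{{_ : NonZero n}} (G : Graph (Fin n)) →
  StrictlyIncreasingOn (λ x → fromℤ 1ℤ ≤ᵣ x) (evalᵣ (D̃ G))
-- The order is `suc n`, so the leading coefficient has a positive exponent, as a strict increase
-- demands.
D̃-strictlyIncreasing {suc n} G = evalᵣ-strictlyIncreasing (D̃ G) (D̃-nonNegCoeffs G) n
  (ℤ.≤∧≢⇒< (D̃-nonNegCoeffs G (suc n)) (coeff-D̃≢0 G (γ̃≤n G) ℕ.≤-refl ∘ sym))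

theorem3 : ∀ (n : ℕ) .{{_ : NonZero n}} (G : Graph (Fin n)) →
    (Connected G → d̃ G n ≡ 1 × (2 ≤ n → d̃ G (n ∸ 1) ≡ n))
    × (∀ i → d̃ G i ≡ 0 ⇔ (i < γ̃ G ⊎ n < i))
    × coeff (D̃ G) 0 ≡ 0ℤ
    × StrictlyIncreasingOn (λ x → fromℤ 1ℤ ≤ᵣ x) (evalᵣ (D̃ G))
    × (∀ (m : ℕ) .{{_ : NonZero m}} (H : Graph (Fin m)) → H IsInducedSubgraphOf G → deg (D̃ G) ≥ deg (D̃ H))
    × IsRootWithMultiplicity (D̃ G) 0ℤ (γ̃ G)
    × (∀ (H : Graph (Fin n)) → H IsSpanningSubgraphOf G → γ̃ G ≤ γ̃ H)
theorem3 n G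
  = (λ conn → d̃[n]≡1 G , d̃[n∸1]≡n G conn)
  , (λ i → mk⇔ (d̃≡0⇒outside-range G) (outside-range⇒d̃≡0 G))
  , coeff-D̃≡0 G (inj₁ (0<γ̃ G))
  , D̃-strictlyIncreasing G
  , (λ m H H⊆G → subst₂ _≤_ (sym (deg-D̃ H)) (sym (deg-D̃ G)) (induced-order-≤ {G = G} H⊆G))
  , 0-isRootWithMultiplicity (D̃ G) (0<γ̃ G) (coeff-D̃≡0 G ∘ inj₁) (coeff-D̃≢0 G ℕ.≤-refl (γ̃≤n G))
  , γ̃-spanning G
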